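{- For every graph $G$, there is a graph $G'$ with the same number of vertices as $G$ such that $G$ is a subgraph of $G'$ and such that $\lfloor \mathrm{sp}\rfloor(G)=\mathrm{sp}(G')$.
   Context: All graphs are finite, have at least one vertex, have no loops, and may have multiple (parallel) edges. A path of order $k+1$ has $k$ edges and $k+1$ distinct vertices. A shortest path from $u$ to $v$ is a $u$–$v$ path such that no $u$–$v$ path has fewer vertices. A unique shortest path is a shortest $u$–$v$ path $P$ such that every $u$–$v$ path with the same number of vertices is identical to $P$, where two paths with different edge sequences are different even if their vertex sequences agree (so no edge of a unique shortest path has a parallel edge); a single vertex is a unique shortest path. The parade number $\mathrm{usp}(G)$ is the largest number of vertices of a unique shortest path in $G$; a parade is a unique shortest path attaining it. The spectator number is $\mathrm{sp}(G)=|V(G)|-\mathrm{usp}(G)$. A minor of a graph $H$ is any graph obtained from $H$ by a sequence of the operations: deleting an isolated vertex, deleting an edge, contracting an edge that has no edge parallel to it. The spectator floor $\lfloor \mathrm{sp}\rfloor(G)$ is the minimum of $\mathrm{sp}(H)$ over all graphs $H$ of which $G$ is a minor. -}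

module Defs where

open import Data.Nat.Base using (ℕ; suc; _∸_; _≤_; NonZero)
open import Data.Fin.Base using (Fin; inject₁) renaming (suc to fsuc)
open import Data.Vec.Base using (Vec; head; last; lookup)
open import Data.Vec.Relation.Unary.Unique.Propositional using (Unique)
open import Data.Product.Base using (Σ; ∃-syntax; _×_; _,_; proj₁; proj₂)
open import Data.Sum.Base using (_⊎_)
open import Function.Bundles using (_↔_; _⇔_; module Inverse)
open import Function.Definitions using (Injective; StrictlySurjective)
open import Relation.Nullary.Negation.Core using (¬_)
open import Relation.Binary.PropositionalEquality.Core using (_≡_; _≢_)
open import Relation.Binary.Construct.Closure.ReflexiveTransitive using (Star)

open Inverse using (to)

-- Edges are undirected: the order of the two components of `ends e` carries
-- no information, and every later notion uses `ends` only through `Joins`.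
record Graph : Set where
  field
    order    : ℕ
    size     : ℕ
    nonEmpty : NonZero order
    ends     : Fin size → Fin order × Fin order
    loopless : ∀ e → proj₁ (ends e) ≢ proj₂ (ends e)

open Graph public

Vertex : Graph → Set
Vertex G = Fin (order G)

Edge : Graph → Set
Edge G = Fin (size G)

Joins : (G : Graph) → Edge G → Vertex G → Vertex G → Set
Joins G e u v = ends G e ≡ (u , v) ⊎ ends G e ≡ (v , u)

Incident : (G : Graph) → Edge G → Vertex G → Set
Incident G e v = ∃[ u ] Joins G e u v

Isolated : (G : Graph) → Vertex G → Set
Isolated G v = ∀ e → ¬ Incident G e v

Parallel : (G : Graph) → Edge G → Edge G → Set
Parallel G e f = e ≢ f × (∃[ u ] ∃[ v ] (Joins G e u v × Joins G f u v))

-- A path with k edges and k + 1 vertices, traversed from u to v.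
record Path (G : Graph) (u v : Vertex G) (k : ℕ) : Set where
  field
    vertices : Vec (Vertex G) (suc k)
    edges    : Vec (Edge G) k
    starts   : head vertices ≡ u
    finishes : last vertices ≡ v
    distinct : Unique vertices
    joined   : ∀ i → Joins G (lookup edges i)
                             (lookup vertices (inject₁ i))
                             (lookup vertices (fsuc i))

open Path public

Identical : ∀ {G u v k} → Path G u v k → Path G u v k → Set
Identical P Q = vertices P ≡ vertices Q × edges P ≡ edges Q

IsShortest : ∀ {G u v k} → Path G u v k → Set
IsShortest {G} {u} {v} {k} _ = ∀ j → Path G u v j → suc k ≤ suc j

IsUniqueShortest : ∀ {G u v k} → Path G u v k → Set
IsUniqueShortest {G} {u} {v} {k} P =
  IsShortest P × (∀ (Q : Path G u v k) → Identical Q P)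

HasUniqueShortestPathOfOrder : Graph → ℕ → Set
HasUniqueShortestPathOfOrder G p =
  ∃[ u ] ∃[ v ] ∃[ k ] Σ (Path G u v k) λ P → IsUniqueShortest P × p ≡ suc k

-- usp(G) = p
IsParadeNumber : Graph → ℕ → Set
IsParadeNumber G p =
  HasUniqueShortestPathOfOrder G p ×
  (∀ q → HasUniqueShortestPathOfOrder G q → q ≤ p)

-- sp(G) = s.  The subtraction never truncates, since the vertices of a path
-- are distinct.
IsSpectatorNumber : Graph → ℕ → Set
IsSpectatorNumber G s = ∃[ p ] (IsParadeNumber G p × s ≡ order G ∸ p)

PreservesEnds : (G H : Graph) → (Vertex G → Vertex H) → (Edge G → Edge H) → Set
PreservesEnds G H φ ψ =
  ∀ e u v → Joins G e u v → Joins H (ψ e) (φ u) (φ v)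

record _≅_ (G H : Graph) : Set where
  field
    onVertices : Vertex G ↔ Vertex H
    onEdges    : Edge G ↔ Edge H
    preserves  : PreservesEnds G H (to onVertices) (to onEdges)

-- Vertices and edges are numbered, so being a subgraph is understood up to
-- renaming the vertices and edges of the smaller graph.
record _⊑_ (G H : Graph) : Set where
  field
    onVertices  : Vertex G → Vertex H
    onEdges     : Edge G → Edge H
    onVertices-injective : Injective _≡_ _≡_ onVertices
    onEdges-injective    : Injective _≡_ _≡_ onEdges
    preserves   : PreservesEnds G H onVertices onEdges

-- f identifies A with B ∖ {b}.
record OntoAllBut {A B : Set} (b : B) (f : A → B) : Set where
  field
    injective : Injective _≡_ _≡_ f
    image     : ∀ y → (∃[ x ] f x ≡ y) ⇔ y ≢ b

-- Each of the next three records says that G is, up to the numbering of its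
-- vertices and edges, the result of the operation applied to H.

record VertexDeletion (H : Graph) (v : Vertex H) (G : Graph) : Set where
  field
    isolated   : Isolated H v
    onVertices : Vertex G → Vertex H
    onEdges    : Edge G ↔ Edge H
    allBut     : OntoAllBut v onVertices
    preserves  : PreservesEnds G H onVertices (to onEdges)

record EdgeDeletion (H : Graph) (e : Edge H) (G : Graph) : Set where
  field
    onVertices : Vertex G ↔ Vertex H
    onEdges    : Edge G → Edge H
    allBut     : OntoAllBut e onEdges
    preserves  : PreservesEnds G H (to onVertices) onEdges

-- The quotient map goes from H to G, while the surviving edges are mapped
-- from G back into H.
record Contraction (H : Graph) (e : Edge H) (G : Graph) : Set where
  field
    noParallel : ∀ f → ¬ Parallel H e f
    quotient   : Vertex H → Vertex G
    surjective : StrictlySurjective _≡_ quotient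
    kernel     : ∀ x y → quotient x ≡ quotient y ⇔ (x ≡ y ⊎ Joins H e x y)
    onEdges    : Edge G → Edge H
    allBut     : OntoAllBut e onEdges
    preserves  : ∀ f x y → Joins H (onEdges f) x y →
                 Joins G f (quotient x) (quotient y)

data _⟶_ (H G : Graph) : Set where
  deleteVertex : ∀ v → VertexDeletion H v G → H ⟶ G
  deleteEdge   : ∀ e → EdgeDeletion H e G → H ⟶ G
  contract     : ∀ e → Contraction H e G → H ⟶ G

-- G is a minor of H.
_≼_ : Graph → Graph → Set
G ≼ H = ∃[ K ] (Star _⟶_ H K × K ≅ G)

-- ⌊sp⌋(G) = s
IsSpectatorFloor : Graph → ℕ → Set
IsSpectatorFloor G s =
  (∃[ H ] (G ≼ H × IsSpectatorNumber H s)) ×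
  (∀ H t → G ≼ H → IsSpectatorNumber H t → s ≤ t)

{-# OPTIONS --safe #-}

-- Give every vertex a level, changing by at most one along each edge, and pick
-- a spine vertex on each of the levels 0, …, k, such that the only possible edge
-- from spine (i + 1) down to level i is a single edge to spine i.  A unique
-- shortest path with k edges yields such a layering (levels are distances from
-- its start, truncated at k); conversely, adding the missing spine edges turns
-- the spine into a unique shortest path without adding vertices.  Merging two
-- adjacent levels removes any chosen spine vertex, so a minor operation that
-- costs one vertex costs at most one level.  Hence ⌊sp⌋(G) = |G| − (k + 1) for
-- the largest k admitting a layering of G, and the completed layering attains it.

module Submission where

open import Defs
open import Data.Product.Base using (∃-syntax; _×_)
open import Relation.Binary.PropositionalEquality.Core using (_≡_)

open import Data.Product.Base using (_,_; proj₁; proj₂)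
open import Data.Product.Properties using (≡-dec)
open import Data.Sum.Base using (_⊎_; inj₁; inj₂; swap; [_,_]′)
open import Data.Nat.Base
  using (ℕ; zero; suc; _+_; _∸_; _⊓_; _≤_; _<_; z≤n; s≤s; s≤s⁻¹; >-nonZero⁻¹)
open import Data.Nat.Properties as ℕ
  using (≤-refl; ≤-trans; ≤-reflexive; ≤-antisym; m≤n⇒m≤1+n; 1+n≰n)
open import Data.Nat.DivMod using (_mod_; m≤n⇒m%n≡m; m%n<n)
open import Data.Nat.Induction using (<-rec)
open import Data.Nat.Solver using (module +-*-Solver)
open import Data.Fin.Base using (Fin; zero; suc; toℕ; fromℕ<; inject₁)
open import Data.Fin.Properties as Fin
  using (_≟_; any?; all?; toℕ-fromℕ<; toℕ<n; toℕ-injective; punchOut-injective; injective⇒≤)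
open import Data.Vec.Base using (Vec; []; _∷_; _∷ʳ_; _++_; head; last; lookup; tabulate)
open import Data.Vec.Properties
  using (last-∷ʳ; ∷ʳ-injectiveˡ; ++-injectiveʳ; ∷-injectiveˡ; lookup∘tabulate)
open import Data.Vec.Relation.Unary.All using (All; []; _∷_)
open import Data.Vec.Relation.Unary.AllPairs using ([]; _∷_)
open import Data.Vec.Relation.Unary.Unique.Propositional using (Unique)
open import Function.Base using (_∘_; id)
open import Function.Bundles
  using (_↔_; mk⇔; module Inverse; module Equivalence; module Injection)
open import Function.Construct.Identity using (↔-id)
open import Function.Definitions using (Injective)
open import Function.Properties.Inverse using (↔-sym; ↔⇒↣)
open import Relation.Nullary using (Dec; yes; no; ¬_; contradiction)
open import Relation.Nullary.Decidable using (map′; _⊎-dec_; _×-dec_; _→-dec_)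
open import Relation.Binary.Construct.Closure.ReflexiveTransitive using (Star; ε; _◅_)
open import Relation.Binary.PropositionalEquality
  using (_≢_; refl; sym; trans; cong; subst; subst₂)

-- Walks and paths.

module _ (G : Graph) where

  joins? : ∀ e x y → Dec (Joins G e x y)
  joins? e x y =
    ≡-dec _≟_ _≟_ (ends G e) (x , y) ⊎-dec ≡-dec _≟_ _≟_ (ends G e) (y , x)

  joins⇒≢ : ∀ e {x y} → Joins G e x y → x ≢ y
  joins⇒≢ e (inj₁ p) refl = loopless G e (trans (cong proj₁ p) (sym (cong proj₂ p)))
  joins⇒≢ e (inj₂ p) refl = loopless G e (trans (cong proj₁ p) (sym (cong proj₂ p)))

  joins-ends : ∀ e → Joins G e (proj₁ (ends G e)) (proj₂ (ends G e))
  joins-ends e = inj₁ refl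

  joins-same : ∀ e {x y x′ y′} → Joins G e x y → Joins G e x′ y′ →
               (x ≡ x′ × y ≡ y′) ⊎ (x ≡ y′ × y ≡ x′)
  joins-same e (inj₁ p) (inj₁ q) with refl ← trans (sym p) q = inj₁ (refl , refl)
  joins-same e (inj₁ p) (inj₂ q) with refl ← trans (sym p) q = inj₂ (refl , refl)
  joins-same e (inj₂ p) (inj₁ q) with refl ← trans (sym p) q = inj₂ (refl , refl)
  joins-same e (inj₂ p) (inj₂ q) with refl ← trans (sym p) q = inj₁ (refl , refl)

  data Walk : Vertex G → Vertex G → ℕ → Set where
    nil  : ∀ {v} → Walk v v 0
    cons : ∀ {u w v k} e → Joins G e u w → Walk w v k → Walk u v (suc k)

module _ {G : Graph} where

  -- The last vertex is left out so that concatenation of walks becomes concatenation of vectors.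
  sources : ∀ {u v k} → Walk G u v k → Vec (Vertex G) k
  sources nil              = []
  sources (cons {u} _ _ w) = u ∷ sources w

  visited : ∀ {u v k} → Walk G u v k → Vec (Vertex G) (suc k)
  visited (nil {v})        = v ∷ []
  visited (cons {u} _ _ w) = u ∷ visited w

  edgesOf : ∀ {u v k} → Walk G u v k → Vec (Edge G) k
  edgesOf nil          = []
  edgesOf (cons e _ w) = e ∷ edgesOf w

  visited-∷ʳ : ∀ {u v k} (w : Walk G u v k) → visited w ≡ sources w ∷ʳ v
  visited-∷ʳ nil              = refl
  visited-∷ʳ (cons {u} _ _ w) = cong (u ∷_) (visited-∷ʳ w)

  _⟫_ : ∀ {u x v k l} → Walk G u x k → Walk G x v l → Walk G u v (k + l)
  nil        ⟫ w′ = w′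
  cons e j w ⟫ w′ = cons e j (w ⟫ w′)

  sources-⟫ : ∀ {u x v k l} (w : Walk G u x k) (w′ : Walk G x v l) →
              sources (w ⟫ w′) ≡ sources w ++ sources w′
  sources-⟫ nil              w′ = refl
  sources-⟫ (cons {u} _ _ w) w′ = cong (u ∷_) (sources-⟫ w w′)

  edgesOf-⟫ : ∀ {u x v k l} (w : Walk G u x k) (w′ : Walk G x v l) →
              edgesOf (w ⟫ w′) ≡ edgesOf w ++ edgesOf w′
  edgesOf-⟫ nil          w′ = refl
  edgesOf-⟫ (cons e _ w) w′ = cong (e ∷_) (edgesOf-⟫ w w′)

  walk? : ∀ u v k → Dec (Walk G u v k)
  walk? u v zero    = map′ (λ { refl → nil }) (λ { nil → refl }) (u ≟ v)
  walk? u v (suc k) =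
    map′ (λ { (e , _ , j , w) → cons e j w }) (λ { (cons e j w) → e , _ , j , w })
      (any? λ e → any? λ x → joins? G e u x ×-dec walk? x v k)

  avoids⊎suffix : ∀ x {u v k} (w : Walk G u v k) →
                  All (x ≢_) (visited w) ⊎ (∃[ j ] (j ≤ k × Walk G x v j))
  avoids⊎suffix x {u} w with x ≟ u
  avoids⊎suffix x w            | yes refl = inj₂ (_ , ≤-refl , w)
  avoids⊎suffix x nil          | no x≢u   = inj₁ (x≢u ∷ [])
  avoids⊎suffix x (cons e j w) | no x≢u with avoids⊎suffix x w
  ... | inj₁ a              = inj₁ (x≢u ∷ a)
  ... | inj₂ (i , i≤k , w′) = inj₂ (i , m≤n⇒m≤1+n i≤k , w′)

  -- If a vertex recurs, the closed walk between two of its visits can be cut out.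
  unique⊎shorter : ∀ {u v k} (w : Walk G u v k) →
                   Unique (visited w) ⊎ (∃[ j ] (j < k × Walk G u v j))
  unique⊎shorter nil = inj₁ ([] ∷ [])
  unique⊎shorter (cons {u} e j w) with avoids⊎suffix u w | unique⊎shorter w
  ... | inj₂ (i , i≤k , w′) | _                   = inj₂ (i , s≤s i≤k , w′)
  ... | inj₁ _              | inj₂ (i , i<k , w′) = inj₂ (suc i , s≤s i<k , cons e j w′)
  ... | inj₁ a              | inj₁ d              = inj₁ (a ∷ d)

  toPath : ∀ {u v k} (w : Walk G u v k) → Unique (visited w) → Path G u v k
  toPath {u} {v} w d = record
    { vertices = visited w
    ; edges    = edgesOf w
    ; starts   = head-visited w
    ; finishes = trans (cong last (visited-∷ʳ w)) (last-∷ʳ v (sources w))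
    ; distinct = d
    ; joined   = joined′ w
    }
    where
    head-visited : ∀ {u v k} (w : Walk G u v k) → head (visited w) ≡ u
    head-visited nil          = refl
    head-visited (cons _ _ _) = refl

    joined′ : ∀ {u v k} (w : Walk G u v k) (i : Fin k) →
              Joins G (lookup (edgesOf w) i) (lookup (visited w) (inject₁ i))
                      (lookup (visited w) (suc i))
    joined′ (cons e j nil)            zero    = j
    joined′ (cons e j (cons _ _ _))   zero    = j
    joined′ (cons e j w)              (suc i) = joined′ w i

  fromVec : ∀ {k} (vs : Vec (Vertex G) (suc k)) (es : Vec (Edge G) k) →
            (∀ i → Joins G (lookup es i) (lookup vs (inject₁ i)) (lookup vs (suc i))) →
            ∃[ w ] (visited {head vs} {last vs} w ≡ vs × edgesOf w ≡ es)
  fromVec (x ∷ [])     []       _ = nil , refl , refl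
  fromVec (x ∷ y ∷ vs) (e ∷ es) j with w , p , q ← fromVec (y ∷ vs) es (j ∘ suc) =
    cons e (j zero) w , cong (x ∷_) p , cong (e ∷_) q

  toWalk : ∀ {u v k} (P : Path G u v k) →
           ∃[ w ] (visited {u} {v} w ≡ vertices P × edgesOf w ≡ edges P)
  toWalk record { vertices = vs ; edges = es ; starts = refl ; finishes = refl ; joined = j } =
    fromVec vs es j

  shorten : ∀ {u v k} → Walk G u v k → ∃[ j ] (j ≤ k × Path G u v j)
  shorten {u} {v} {k} = <-rec (λ k → Walk G u v k → ∃[ j ] (j ≤ k × Path G u v j)) step k
    where
    step : ∀ k → (∀ {i} → i < k → Walk G u v i → ∃[ j ] (j ≤ i × Path G u v j)) →
           Walk G u v k → ∃[ j ] (j ≤ k × Path G u v j)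
    step k rec w with unique⊎shorter w
    ... | inj₁ d              = k , ≤-refl , toPath w d
    ... | inj₂ (i , i<k , w′) with j , j≤i , P ← rec i<k w′ =
      j , ≤-trans j≤i (ℕ.<⇒≤ i<k) , P

  -- Total in the index, so that it can serve as a spine; beyond the length it stays at the final
  -- vertex.
  at : ∀ {u v k} → Walk G u v k → ℕ → Vertex G
  at (nil {v})        _       = v
  at (cons {u} _ _ _) zero    = u
  at (cons _ _ w)     (suc i) = at w i

  at-zero : ∀ {u v k} (w : Walk G u v k) → at w 0 ≡ u
  at-zero nil          = refl
  at-zero (cons _ _ _) = refl

  prefix : ∀ {u v k i} (w : Walk G u v k) → i ≤ k → Walk G u (at w i) i
  prefix nil          z≤n     = nil
  prefix (cons e j w) z≤n     = nil
  prefix (cons e j w) (s≤s p) = cons e j (prefix w p)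

  suffix : ∀ {u v k i} (w : Walk G u v k) → i ≤ k → Walk G (at w i) v (k ∸ i)
  suffix nil          z≤n     = nil
  suffix (cons e j w) z≤n     = cons e j w
  suffix (cons e j w) (s≤s p) = suffix w p

  edge-at : ∀ {u v k i} (w : Walk G u v k) → i < k →
            ∃[ e ] Joins G e (at w i) (at w (suc i))
  edge-at {i = zero}  (cons e j w) _       = e , subst (Joins G e _) (sym (at-zero w)) j
  edge-at {i = suc i} (cons e j w) (s≤s p) = edge-at w p

-- Bounded minimisation.

-- The value is the bound itself when nothing below it satisfies P.
least : {P : ℕ → Set} → (∀ j → Dec (P j)) → ℕ → ℕ
least P? zero    = zero
least P? (suc k) with P? 0
... | yes _ = zero
... | no _  = suc (least (P? ∘ suc) k)

least-holds : {P : ℕ → Set} (P? : ∀ j → Dec (P j)) (k : ℕ) → least P? k < k → P (least P? k)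
least-holds P? (suc k) lt with P? 0
... | yes p = p
... | no _  = least-holds (P? ∘ suc) k (s≤s⁻¹ lt)

least-lower : {P : ℕ → Set} (P? : ∀ j → Dec (P j)) (k : ℕ) → ∀ j → P j → least P? k ≤ j
least-lower P? zero    j p = z≤n
least-lower P? (suc k) j p with P? 0
least-lower P? (suc k) j       p | yes _ = z≤n
least-lower P? (suc k) zero    p | no ¬p = contradiction p ¬p
least-lower P? (suc k) (suc j) p | no _  = s≤s (least-lower (P? ∘ suc) k j p)

least≤ : {P : ℕ → Set} (P? : ∀ j → Dec (P j)) (k : ℕ) → least P? k ≤ k
least≤ P? zero    = z≤n
least≤ P? (suc k) with P? 0
... | yes _ = z≤n
... | no _  = s≤s (least≤ (P? ∘ suc) k)

-- Layerings, and the layering of a unique shortest path.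

-- Only the values spine 0, …, spine k matter.
record IsLayering (G : Graph) (k : ℕ) (level : Vertex G → ℕ) (spine : ℕ → Vertex G) : Set where
  field
    level-spine    : ∀ {i} → i ≤ k → level (spine i) ≡ i
    lipschitz      : ∀ e {x y} → Joins G e x y → level x ≤ suc (level y)
    descent        : ∀ e {i y} → i < k → Joins G e (spine (suc i)) y → level y ≡ i → y ≡ spine i
    descent-unique : ∀ e f {i} → i < k → Joins G e (spine (suc i)) (spine i) →
                     Joins G f (spine (suc i)) (spine i) → e ≡ f

record Layering (G : Graph) (k : ℕ) : Set where
  constructor layering
  field
    level      : Vertex G → ℕ
    spine      : ℕ → Vertex G
    isLayering : IsLayering G k level spine
  open IsLayering isLayering public

usp⇒layering : ∀ {G u v k} (P : Path G u v k) → IsUniqueShortest P → Layering G k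
usp⇒layering {G} {u} {v} {k} P (short , unique) = layering level (at w₀) record
  { level-spine    = level-spine
  ; lipschitz      = lipschitz
  ; descent        = λ e i<k j l → proj₁ (descent e i<k j l)
  ; descent-unique = λ e f i<k j j′ →
      let l = level-spine (ℕ.<⇒≤ i<k) in
      trans (proj₂ (descent e i<k j l)) (sym (proj₂ (descent f i<k j′ l)))
  }
  where
  w₀ : Walk G u v k
  w₀ = proj₁ (toWalk P)

  minimal : ∀ {j} → Walk G u v j → k ≤ j
  minimal w with i , i≤j , Q ← shorten w = ≤-trans (s≤s⁻¹ (short i Q)) i≤j

  -- A walk of length `k` from `u` to `v` cannot be shortened, so it is a path and must be `P`. The
  -- length is given up to an equation because concatenated walks have sums as lengths.
  determined : ∀ {m} → m ≡ k → (w : Walk G u v m) →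
               ∀ w′ → sources w ≡ sources w′ × edgesOf w ≡ edgesOf w′
  determined refl w w′ with unique⊎shorter w | unique⊎shorter w′
  ... | inj₂ (_ , i<k , s) | _                  = contradiction (minimal s) (ℕ.<⇒≱ i<k)
  ... | inj₁ _             | inj₂ (_ , i<k , s) = contradiction (minimal s) (ℕ.<⇒≱ i<k)
  ... | inj₁ d             | inj₁ d′
    with p , q ← unique (toPath w d) | p′ , q′ ← unique (toPath w′ d′) =
      ∷ʳ-injectiveˡ _ _
        (trans (sym (visited-∷ʳ w)) (trans p (trans (sym p′) (visited-∷ʳ w′)))) ,
      trans q (sym q′)

  level : Vertex G → ℕ
  level x = least (walk? u x) k

  reach : ∀ {x} → level x < k → Walk G u x (level x)
  reach {x} = least-holds (walk? u x) k

  level≤ : ∀ {x j} → Walk G u x j → level x ≤ j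
  level≤ {x} {j} = least-lower (walk? u x) k j

  lipschitz : ∀ e {x y} → Joins G e x y → level x ≤ suc (level y)
  lipschitz e {x} {y} j with level y ℕ.<? k
  ... | yes l = ≤-trans (level≤ (reach l ⟫ cons e (swap j) nil))
                        (≤-reflexive (ℕ.+-comm (level y) 1))
  -- Here `y` sits at the cutoff `k`, which bounds every level.
  ... | no ¬l = ≤-trans (least≤ (walk? u x) k) (m≤n⇒m≤1+n (ℕ.≮⇒≥ ¬l))

  -- A shorter walk to the vertex in position `i`, continued along the rest of `w₀`, would beat the
  -- length `k`.
  level-spine : ∀ {i} → i ≤ k → level (at w₀ i) ≡ i
  level-spine {i} i≤k with level (at w₀ i) ℕ.<? i
  ... | no ¬l = ≤-antisym (level≤ (prefix w₀ i≤k)) (ℕ.≮⇒≥ ¬l)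
  ... | yes l = contradiction (minimal (reach (ℕ.<-≤-trans l i≤k) ⟫ suffix w₀ i≤k))
    (ℕ.<⇒≱ (subst (level (at w₀ i) + (k ∸ i) <_) (ℕ.m+[n∸m]≡n i≤k)
                  (ℕ.+-monoˡ-< (k ∸ i) l)))

  -- A shortest walk to `y`, then `e`, then the rest of `w₀` has length `k`, hence agrees with `w₀`.
  -- Stripping the first `i` sources and edges from both leaves `y` and `e` in front.
  descent : ∀ e {i y} (i<k : i < k) → Joins G e (at w₀ (suc i)) y → level y ≡ i →
            y ≡ at w₀ i × e ≡ proj₁ (edge-at w₀ i<k)
  descent e {i} {y} i<k j refl =
    ∷-injectiveˡ (++-injectiveʳ (sources p) (sources p′)
      (trans (sym (sources-⟫ p c)) (trans (proj₁ same) (sources-⟫ p′ c′)))) ,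
    ∷-injectiveˡ (++-injectiveʳ (edgesOf p) (edgesOf p′)
      (trans (sym (edgesOf-⟫ p c)) (trans (proj₂ same) (edgesOf-⟫ p′ c′))))
    where
    p    = reach i<k
    p′   = prefix w₀ (ℕ.<⇒≤ i<k)
    c    = cons e (swap j) (suffix w₀ i<k)
    c′   = cons (proj₁ (edge-at w₀ i<k)) (proj₂ (edge-at w₀ i<k)) (suffix w₀ i<k)
    same = determined (trans (ℕ.+-suc i (k ∸ suc i)) (ℕ.m+[n∸m]≡n i<k)) (p ⟫ c) (p′ ⟫ c′)

-- From layerings to unique shortest paths.

module _ {G k} (L : Layering G k) where
  open Layering L

  level-walk : ∀ {u v m} → Walk G u v m → level v ≤ m + level u
  level-walk nil = ≤-refl
  level-walk (cons {u} {w} {v} {m} e j W) = begin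
    level v           ≤⟨ level-walk W ⟩
    m + level w       ≤⟨ ℕ.+-monoʳ-≤ m (lipschitz e (swap j)) ⟩
    m + suc (level u) ≡⟨ ℕ.+-suc m (level u) ⟩
    suc m + level u   ∎
    where open ℕ.≤-Reasoning

  -- A step gains at most one level, so a walk with exactly as many steps as levels to climb must
  -- gain one at each step.
  ascends : ∀ {x y m} e → Joins G e x y → Walk G y (spine k) m → suc m + level x ≡ k →
            level y ≡ suc (level x)
  ascends {x} {y} {m} e j W eq = ≤-antisym (lipschitz e (swap j)) (ℕ.+-cancelˡ-≤ m _ _ (begin
    m + suc (level x)  ≡⟨ ℕ.+-suc m (level x) ⟩
    suc m + level x    ≡⟨ eq ⟩
    k                  ≡⟨ level-spine ≤-refl ⟨
    level (spine k)    ≤⟨ level-walk W ⟩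
    m + level y        ∎))
    where open ℕ.≤-Reasoning

  tight : ∀ {x y m} e → Joins G e x y → Walk G y (spine k) m → suc m + level x ≡ k →
          m + level y ≡ k
  tight {x} {m = m} e j W eq =
    trans (cong (m +_) (ascends e j W eq)) (trans (ℕ.+-suc m (level x)) eq)

  below : ∀ {l m} → suc m + l ≡ k → l < k
  below {l} {m} refl = s≤s (ℕ.m≤n+m l m)

  -- Induction from the far end: the next vertex is on the spine, and read backwards the first edge
  -- descends from it, so `descent` puts `x` on the spine too.
  tight⇒spine : ∀ {x m} → Walk G x (spine k) m → m + level x ≡ k → x ≡ spine (level x)
  tight⇒spine nil          eq = cong spine (sym eq)
  tight⇒spine (cons {w = y} e j W) eq =
    descent e (below eq)
      (swap (subst (Joins G e _)
        (trans (tight⇒spine W (tight e j W eq)) (cong spine (ascends e j W eq))) j))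
      refl

  -- `tight⇒spine` forces the vertices, and then `descent-unique` forces the edges.
  tight-unique : ∀ {x m} (W W′ : Walk G x (spine k) m) → m + level x ≡ k →
                 visited W ≡ visited W′ × edgesOf W ≡ edgesOf W′
  tight-unique {x} {zero} nil nil _ = refl , refl
  tight-unique {x} {suc m} (cons {w = y} e j W) (cons {w = y′} f j′ W′) eq
    with here ← tight⇒spine (cons e j W) eq
       | next ← trans (tight⇒spine W (tight e j W eq)) (cong spine (ascends e j W eq))
       | next′ ← trans (tight⇒spine W′ (tight f j′ W′ eq)) (cong spine (ascends f j′ W′ eq))
    with refl ← trans next (sym next′)
    with refl ← descent-unique e f (below eq)
                  (swap (subst₂ (Joins G e) here next j))
                  (swap (subst₂ (Joins G f) here next j′))
    with p , q ← tight-unique W W′ (tight e j W eq)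
    = cong (x ∷_) p , cong (e ∷_) q

  SpineEdge : ℕ → Set
  SpineEdge i = ∃[ e ] Joins G e (spine i) (spine (suc i))

  spineWalk : (∀ {i} → i < k → SpineEdge i) → ∀ m i → m + i ≡ k → Walk G (spine i) (spine k) m
  spineWalk edge zero    i refl = nil
  spineWalk edge (suc m) i eq   with e , j ← edge (below eq) =
    cons e j (spineWalk edge m (suc i) (trans (ℕ.+-suc m i) eq))

  spanned⇒usp : (∀ {i} → i < k → SpineEdge i) → HasUniqueShortestPathOfOrder G (suc k)
  spanned⇒usp edge = _ , _ , k , toPath W d , (shortest , unique) , refl
    where
    W : Walk G (spine 0) (spine k) k
    W = spineWalk edge k 0 (ℕ.+-identityʳ k)

    full : k + level (spine 0) ≡ k
    full = trans (cong (k +_) (level-spine z≤n)) (ℕ.+-identityʳ k)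

    minimal : ∀ {m} → Walk G (spine 0) (spine k) m → k ≤ m
    minimal {m} w = begin
      k                     ≡⟨ level-spine ≤-refl ⟨
      level (spine k)       ≤⟨ level-walk w ⟩
      m + level (spine 0)   ≡⟨ cong (m +_) (level-spine z≤n) ⟩
      m + 0                 ≡⟨ ℕ.+-identityʳ m ⟩
      m                     ∎
      where open ℕ.≤-Reasoning

    d : Unique (visited W)
    d with unique⊎shorter W
    ... | inj₁ d             = d
    ... | inj₂ (_ , i<k , w) = contradiction (minimal w) (ℕ.<⇒≱ i<k)

    shortest : ∀ j → Path G (spine 0) (spine k) j → suc k ≤ suc j
    shortest j Q = s≤s (minimal (proj₁ (toWalk Q)))

    unique : (Q : Path G (spine 0) (spine k) k) → Identical Q (toPath W d)
    unique Q with w , p , q ← toWalk Q | p′ , q′ ← tight-unique (proj₁ (toWalk Q)) W full =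
      trans (sym p) p′ , trans (sym q) q′

-- Arithmetic of merging two levels.

-- merge j identifies the levels j and j + 1, and skip j enumerates the levels
-- other than j.
merge : ℕ → ℕ → ℕ
merge j       zero    = zero
merge zero    (suc x) = x
merge (suc j) (suc x) = suc (merge j x)

skip : ℕ → ℕ → ℕ
skip zero    i       = suc i
skip (suc j) zero    = zero
skip (suc j) (suc i) = suc (skip j i)

merge-skip : ∀ j i → merge j (skip j i) ≡ i
merge-skip zero    i       = refl
merge-skip (suc j) zero    = refl
merge-skip (suc j) (suc i) = cong suc (merge-skip j i)

merge-lipschitz : ∀ j {x y} → x ≤ suc y → merge j x ≤ suc (merge j y)
merge-lipschitz j       {zero}          p             = z≤n
merge-lipschitz zero    {suc x} {zero}  (s≤s z≤n)     = z≤n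
merge-lipschitz zero    {suc x} {suc y} (s≤s p)       = p
merge-lipschitz (suc j) {suc x} {zero}  (s≤s z≤n)     = s≤s z≤n
merge-lipschitz (suc j) {suc x} {suc y} (s≤s p)       = s≤s (merge-lipschitz j p)

merge-level : ∀ {x y} → x ≤ y → y ≤ suc x → merge x y ≡ merge x x
merge-level {zero}  {zero}  _       _         = refl
merge-level {zero}  {suc _} _       (s≤s z≤n) = refl
merge-level {suc x} {suc y} (s≤s p) (s≤s q)   = cong suc (merge-level p q)

merge-below : ∀ i y → merge (suc i) y ≡ i → y ≡ i
merge-below i       zero    eq = eq
merge-below (suc i) (suc y) eq = cong suc (merge-below i y (ℕ.suc-injective eq))

skip≤ : ∀ j i → skip j i ≤ suc i
skip≤ zero    i       = ≤-refl
skip≤ (suc j) zero    = z≤n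
skip≤ (suc j) (suc i) = s≤s (skip≤ j i)

skip≢ : ∀ j i → skip j i ≢ j
skip≢ (suc j) (suc i) eq = skip≢ j i (ℕ.suc-injective eq)

skip-here : ∀ j i → skip j i ≡ suc j → i ≡ j
skip-here zero    i       eq = ℕ.suc-injective eq
skip-here (suc j) (suc i) eq = cong suc (skip-here j i (ℕ.suc-injective eq))

skip-below : ∀ i → skip (suc i) i ≡ i
skip-below zero    = refl
skip-below (suc i) = cong suc (skip-below i)

-- Only two cases could go wrong: `y` is the omitted level `j` itself, or `skip j` jumps over `j`
-- between `i` and `suc i`. In both, `skip j (suc i)` would exceed `y` by two.
skip-descent : ∀ j i y → skip j (suc i) ≤ suc y → merge j y ≡ i →
               y ≡ skip j i × skip j (suc i) ≡ suc y
skip-descent zero          i       (suc y) p       refl = refl , refl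
skip-descent (suc zero)    zero    zero    (s≤s ()) eq
skip-descent (suc (suc j)) zero    zero    p       eq   = refl , refl
skip-descent zero          i       zero    (s≤s ()) eq
skip-descent (suc j)       (suc i) (suc y) (s≤s p) eq
  with q , r ← skip-descent j i y p (ℕ.suc-injective eq) = cong suc q , cong suc r

m⊓n≡o∧o<n⇒m≡o : ∀ m {n o} → m ⊓ n ≡ o → o < n → m ≡ o
m⊓n≡o∧o<n⇒m≡o m {n} eq o<n with ℕ.⊓-sel m n
... | inj₁ p = trans (sym p) eq
... | inj₂ p = contradiction (trans (sym eq) p) (ℕ.<⇒≢ o<n)

missed⇒< : ∀ {m n} {f : Fin m → Fin n} → Injective _≡_ _≡_ f → ∀ b → (∀ x → b ≢ f x) → m < n
missed⇒< {n = suc n} inj b b≢ =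
  s≤s (injective⇒≤ λ {x} {y} eq → inj (punchOut-injective (b≢ x) (b≢ y) eq))

↔-injective : {A B : Set} (f : A ↔ B) → Injective _≡_ _≡_ (Inverse.to f)
↔-injective f = Injection.injective (↔⇒↣ f)

-- Dropping a level and restricting to a subgraph.

-- By `skip-descent`, an edge descending from a new spine vertex already descended by one level
-- before, so the old conditions apply to it. The index `j` is arbitrary: if it exceeds `k`, the
-- spine merely loses its top vertex.
drop : ∀ {G k} j (L : Layering G (suc k)) →
       IsLayering G k (merge j ∘ Layering.level L) (Layering.spine L ∘ skip j)
drop {G} {k} j L = record
  { level-spine    = λ {i} i≤k → trans (cong (merge j) (level-skip i≤k)) (merge-skip j i)
  ; lipschitz      = λ e J → merge-lipschitz j (lipschitz e J)
  ; descent        = λ e {i} {y} i<k J l →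
      let p , q = skipped e i<k J l
      in descent e (bound i<k)
           (subst (λ n → Joins G e (spine n) y) (trans q (cong suc p)) J) p
  ; descent-unique = λ e f {i} i<k J J′ →
      let p , q = skipped e i<k J
                    (trans (cong (merge j) (level-skip (ℕ.<⇒≤ i<k))) (merge-skip j i))
          r     = trans q (cong suc p)
          r′    = subst (λ n → skip j (suc i) ≡ suc n) (level-skip (ℕ.<⇒≤ i<k)) q
          move  = λ e → subst (λ n → Joins G e (spine n) (spine (skip j i))) r′
      in descent-unique e f (bound i<k) (move e J) (move f J′)
  }
  where
  open Layering L

  bound : ∀ {i} → i < k → skip j i < suc k
  bound {i} i<k = s≤s (≤-trans (skip≤ j i) i<k)

  level-skip : ∀ {i} → i ≤ k → level (spine (skip j i)) ≡ skip j i
  level-skip {i} i≤k = level-spine (≤-trans (skip≤ j i) (s≤s i≤k))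

  skipped : ∀ e {i y} → i < k → Joins G e (spine (skip j (suc i))) y → merge j (level y) ≡ i →
            level y ≡ skip j i × skip j (suc i) ≡ suc (level y)
  skipped e {i} {y} i<k J l =
    skip-descent j i (level y)
      (subst (_≤ suc (level y)) (level-skip i<k) (lipschitz e J)) l

-- Truncating levels at `k` is harmless because descents only concern target levels below `k`.
-- Asking for equations instead of fixing `level′` and `spine′` lets the same lemma serve for
-- subgraphs and for the finite encoding in `layering?`.
restrict : ∀ {K H k} (ι : K ⊑ H) (L : Layering H k) {level′ spine′} →
           (∀ x → level′ x ≡ Layering.level L (_⊑_.onVertices ι x) ⊓ k) →
           (∀ {i} → i ≤ k → _⊑_.onVertices ι (spine′ i) ≡ Layering.spine L i) →
           IsLayering K k level′ spine′
restrict {K} {H} {k} ι L {level′} {spine′} hl hs = record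
  { level-spine    = λ {i} i≤k → trans (hl (spine′ i))
      (trans (cong (_⊓ k) (trans (cong level (hs i≤k)) (level-spine i≤k))) (ℕ.m≤n⇒m⊓n≡m i≤k))
  ; lipschitz      = λ e {x} {y} J →
      subst₂ (λ a b → a ≤ suc b) (sym (hl x)) (sym (hl y))
        (ℕ.⊓-mono-≤ (lipschitz (onEdges e) (preserves e x y J)) (ℕ.n≤1+n k))
  ; descent        = λ e {i} {y} i<k J l → onVertices-injective
      (trans (descent (onEdges e) i<k
               (subst (λ s → Joins H (onEdges e) s (onVertices y)) (hs i<k) (preserves e _ _ J))
               (m⊓n≡o∧o<n⇒m≡o (level (onVertices y)) (trans (sym (hl y)) l) i<k))
             (sym (hs (ℕ.<⇒≤ i<k))))
  ; descent-unique = λ e f {i} i<k J J′ →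
      let move = λ e J → subst₂ (Joins H (onEdges e)) (hs i<k) (hs (ℕ.<⇒≤ i<k)) (preserves e _ _ J)
      in onEdges-injective (descent-unique _ _ i<k (move e J) (move f J′))
  }
  where
  open Layering L
  open _⊑_ ι

-- Layerings under isomorphism and deletion.

⊑-refl : ∀ {G} → G ⊑ G
⊑-refl = record
  { onVertices = id ; onEdges = id ; onVertices-injective = id ; onEdges-injective = id
  ; preserves = λ _ _ _ → id }

⊑-trans : ∀ {G H K} → G ⊑ H → H ⊑ K → G ⊑ K
⊑-trans p q = record
  { onVertices           = Q.onVertices ∘ P.onVertices
  ; onEdges              = Q.onEdges ∘ P.onEdges
  ; onVertices-injective = P.onVertices-injective ∘ Q.onVertices-injective
  ; onEdges-injective    = P.onEdges-injective ∘ Q.onEdges-injective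
  ; preserves            = λ e u v → Q.preserves _ _ _ ∘ P.preserves e u v
  }
  where
  module P = _⊑_ p
  module Q = _⊑_ q

-- Levels are lost at most as fast as vertices; the inequality between differences is written with
-- sums to avoid truncated subtraction.
Inherits : Graph → Graph → Set
Inherits H G = ∀ {k} → Layering H k → ∃[ k′ ] (Layering G k′ × order G + k ≤ order H + k′)

inherits-trans : ∀ {H K G} → Inherits H K → Inherits K G → Inherits H G
inherits-trans {H} {K} {G} p q {k} L with k₁ , L₁ , le₁ ← p L with k₂ , L₂ , le₂ ← q L₁ =
  k₂ , L₂ , ℕ.+-cancelʳ-≤ (order K + k₁) _ _ (begin
    (order G + k) + (order K + k₁) ≡⟨ exchange (order G) k (order K) k₁ ⟩
    (order G + k₁) + (order K + k) ≤⟨ ℕ.+-mono-≤ le₂ le₁ ⟩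
    (order K + k₂) + (order H + k₁) ≡⟨ ℕ.+-comm (order K + k₂) (order H + k₁) ⟩
    (order H + k₁) + (order K + k₂) ≡⟨ exchange (order H) k₁ (order K) k₂ ⟩
    (order H + k₂) + (order K + k₁) ∎)
  where
  open ℕ.≤-Reasoning
  exchange : ∀ a b c d → (a + b) + (c + d) ≡ (a + d) + (c + b)
  exchange = solve 4 (λ a b c d → (a :+ b) :+ (c :+ d) := (a :+ d) :+ (c :+ b)) refl
    where open +-*-Solver

inherits-⊑ : ∀ {H G} (ι : G ⊑ H) (back : Vertex H → Vertex G) →
             (∀ x → _⊑_.onVertices ι (back x) ≡ x) → Inherits H G
inherits-⊑ ι back inv {k} L =
  k , layering _ (back ∘ Layering.spine L) (restrict ι L (λ _ → refl) (λ _ → inv _)) ,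
  ℕ.+-monoˡ-≤ k (injective⇒≤ (_⊑_.onVertices-injective ι))

-- An isomorphism is only required to preserve ends from `K` to `G`. The converse holds because an
-- edge has just one unordered pair of ends.
≅⇒⊒ : ∀ {K G} → K ≅ G → G ⊑ K
≅⇒⊒ {K} {G} iso = record
  { onVertices = V.from ; onEdges = E.from
  ; onVertices-injective = ↔-injective (↔-sym (_≅_.onVertices iso))
  ; onEdges-injective = ↔-injective (↔-sym (_≅_.onEdges iso))
  ; preserves = back
  }
  where
  module V = Inverse (_≅_.onVertices iso)
  module E = Inverse (_≅_.onEdges iso)

  move : ∀ {e u v} → Joins K e u v → Joins K e (V.from (V.to u)) (V.from (V.to v))
  move = subst₂ (Joins K _) (sym (V.strictlyInverseʳ _)) (sym (V.strictlyInverseʳ _))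

  back : ∀ e u v → Joins G e u v → Joins K (E.from e) (V.from u) (V.from v)
  back e u v J
    with joins-same G e J (subst (λ e → Joins G e _ _) (E.strictlyInverseˡ e)
           (_≅_.preserves iso (E.from e) _ _ (joins-ends K (E.from e))))
  ... | inj₁ (refl , refl) = move (joins-ends K _)
  ... | inj₂ (refl , refl) = move (swap (joins-ends K _))

inherits-≅ : ∀ {K G} → K ≅ G → Inherits K G
inherits-≅ iso = inherits-⊑ (≅⇒⊒ iso) to strictlyInverseʳ
  where open Inverse (_≅_.onVertices iso)

someVertex : ∀ G → Vertex G
someVertex G = fromℕ< (>-nonZero⁻¹ (order G) {{nonEmpty G}})

trivial : ∀ G → Layering G 0
trivial G = layering (λ _ → 0) (λ _ → someVertex G) record
  { level-spine    = λ { z≤n → refl }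
  ; lipschitz      = λ _ _ → z≤n
  ; descent        = λ _ ()
  ; descent-unique = λ _ _ ()
  }

-- The lost vertex pays for one lost level; with no level to lose, the trivial layering will do.
inherits-smaller : ∀ {H G} → order G < order H →
                   (∀ {k} → Layering H (suc k) → Layering G k) → Inherits H G
inherits-smaller {H} {G} lt f {zero}  L = 0 , trivial G , ℕ.+-monoˡ-≤ 0 (ℕ.<⇒≤ lt)
inherits-smaller {H} {G} lt f {suc k} L =
  k , f L , ≤-trans (≤-reflexive (ℕ.+-suc (order G) k)) (ℕ.+-monoˡ-≤ k lt)

-- Dropping the level of `b` keeps `b` off the spine, and what remains restricts to `G`.
inherits-deleteVertex : ∀ {H v G} → VertexDeletion H v G → Inherits H G
inherits-deleteVertex {H} {b} {G} D = inherits-smaller (missed⇒< injective b missed) remove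
  where
  open VertexDeletion D
  open OntoAllBut allBut

  missed : ∀ x → b ≢ onVertices x
  missed x eq = Equivalence.to (image b) (x , sym eq) refl

  G⊑H : G ⊑ H
  G⊑H = record
    { onVertices = onVertices ; onEdges = Inverse.to onEdges
    ; onVertices-injective = injective ; onEdges-injective = ↔-injective onEdges
    ; preserves = preserves }

  back : Vertex H → Vertex G
  back y with y ≟ b
  -- An arbitrary value: the relevant spine vertices all differ from `b`.
  ... | yes _  = someVertex G
  ... | no y≢b = proj₁ (Equivalence.from (image y) y≢b)

  back-inverse : ∀ {y} → y ≢ b → onVertices (back y) ≡ y
  back-inverse {y} y≢b with y ≟ b
  ... | yes eq  = contradiction eq y≢b
  ... | no y≢b′ = proj₂ (Equivalence.from (image y) y≢b′)

  remove : ∀ {k} → Layering H (suc k) → Layering G k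
  remove L = layering _ (back ∘ spine ∘ skip (level b))
    (restrict G⊑H (layering _ _ (drop (level b) L)) (λ _ → refl)
      λ {i} i≤k → back-inverse λ eq → skip≢ (level b) i
        (trans (sym (level-spine (≤-trans (skip≤ (level b) i) (s≤s i≤k)))) (cong level eq)))
    where open Layering L

inherits-deleteEdge : ∀ {H e G} → EdgeDeletion H e G → Inherits H G
inherits-deleteEdge D = inherits-⊑ ι (Inverse.from onVertices) (Inverse.strictlyInverseˡ onVertices)
  where
  open EdgeDeletion D
  ι = record
    { onVertices = Inverse.to onVertices ; onEdges = onEdges
    ; onVertices-injective = ↔-injective onVertices
    ; onEdges-injective = OntoAllBut.injective allBut
    ; preserves = preserves }

-- Layerings under contraction.

module _ {H e K} (C : Contraction H e K) where
  open Contraction C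

  section : Vertex K → Vertex H
  section z = proj₁ (surjective z)

  quotient-section : ∀ z → quotient (section z) ≡ z
  quotient-section z = proj₂ (surjective z)

  -- `section` is injective, and it misses one end of `e` because both ends have the same image.
  contraction-< : order K < order H
  contraction-< = go
    where
    a b : Vertex H
    a = proj₁ (ends H e)
    b = proj₂ (ends H e)

    qa≡qb : quotient a ≡ quotient b
    qa≡qb = Equivalence.from (kernel a b) (inj₂ (joins-ends H e))

    injective : Injective _≡_ _≡_ section
    injective {x} {y} eq =
      trans (sym (quotient-section x)) (trans (cong quotient eq) (quotient-section y))

    missed : ∀ c → c ≢ section (quotient c) → ∀ z → c ≢ section z
    missed c c≢ z eq =
      c≢ (trans eq (cong section (trans (sym (quotient-section z)) (cong quotient (sym eq)))))

    go : order K < order H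
    go with a ≟ section (quotient a)
    ... | no a≢  = missed⇒< injective a (missed a a≢)
    ... | yes a≡ = missed⇒< injective b (missed b λ b≡ →
            loopless H e (trans a≡ (trans (cong section qa≡qb) (sym b≡))))

  joins-lift : ∀ g {X Y} → Joins K g X Y →
               ∃[ x ] ∃[ y ] (Joins H (onEdges g) x y × quotient x ≡ X × quotient y ≡ Y)
  joins-lift g J with joins-same K g (preserves g _ _ (joins-ends H (onEdges g))) J
  ... | inj₁ (p , q) = _ , _ , joins-ends H (onEdges g) , p , q
  ... | inj₂ (p , q) = _ , _ , swap (joins-ends H (onEdges g)) , q , p

  -- `level-e` makes levels constant on the fibres of the quotient. `descent-e` concerns a spine
  -- vertex fused with its neighbour `x` along `e`: all descending edges of the fused vertex must
  -- come from `x`, and they must obey the spine conditions there.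
  module _ {k level spine} (L : IsLayering H k level spine)
           (level-e : ∀ {x y} → Joins H e x y → level x ≡ level y)
           (descent-e : ∀ {x i} → i < k → Joins H e x (spine (suc i)) →
             (∀ g {y} → Joins H g (spine (suc i)) y → level y ≢ i) ×
             (∀ g {y} → Joins H g x y → level y ≡ i → y ≡ spine i) ×
             (∀ g h → Joins H g x (spine i) → Joins H h x (spine i) → g ≡ h)) where
    open IsLayering L

    level-section : ∀ x → level (section (quotient x)) ≡ level x
    level-section x with Equivalence.to (kernel _ x) (quotient-section (quotient x))
    ... | inj₁ eq = cong level eq
    ... | inj₂ J  = level-e J

    -- The end `x` from which the lifted edge leaves is kept so that two lifts can be compared for
    -- uniqueness.
    descent-lift : ∀ g {i Y} → i < k → Joins K g (quotient (spine (suc i))) Y →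
                   level (section Y) ≡ i →
                   Y ≡ quotient (spine i) ×
                   (∃[ x ] ((x ≡ spine (suc i) ⊎ Joins H e x (spine (suc i))) ×
                            Joins H (onEdges g) x (spine i)))
    descent-lift g {i} i<k J l
      with x , y , J′ , p , refl ← joins-lift g J
      with l′ ← trans (sym (level-section y)) l
      with Equivalence.to (kernel x _) p
    ... | inj₁ refl with refl ← descent (onEdges g) i<k J′ l′ =
      refl , x , inj₁ refl , J′
    ... | inj₂ Je   with refl ← proj₁ (proj₂ (descent-e i<k Je)) (onEdges g) J′ l′ =
      refl , x , inj₂ Je , J′

    contracted : IsLayering K k (level ∘ section) (quotient ∘ spine)
    contracted = record
      { level-spine    = level-spine′
      ; lipschitz      = λ g J → lipschitz′ g (joins-lift g J)
      ; descent        = λ g i<k J l → proj₁ (descent-lift g i<k J l)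
      ; descent-unique = λ g h i<k J J′ →
          let l = level-spine′ (ℕ.<⇒≤ i<k)
          in OntoAllBut.injective allBut
               (same i<k (proj₂ (descent-lift g i<k J l)) (proj₂ (descent-lift h i<k J′ l)))
      }
      where
      level-spine′ : ∀ {i} → i ≤ k → level (section (quotient (spine i))) ≡ i
      level-spine′ i≤k = trans (level-section _) (level-spine i≤k)

      lipschitz′ : ∀ g {X Y} →
        ∃[ x ] ∃[ y ] (Joins H (onEdges g) x y × quotient x ≡ X × quotient y ≡ Y) →
        level (section X) ≤ suc (level (section Y))
      lipschitz′ g (x , y , J , refl , refl) =
        subst₂ (λ m n → m ≤ suc n) (sym (level-section x)) (sym (level-section y))
          (lipschitz (onEdges g) J)

      same : ∀ {i g h} → i < k →
        ∃[ x ] ((x ≡ spine (suc i) ⊎ Joins H e x (spine (suc i))) × Joins H g x (spine i)) →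
        ∃[ x ] ((x ≡ spine (suc i) ⊎ Joins H e x (spine (suc i))) × Joins H h x (spine i)) →
        g ≡ h
      same i<k (_ , inj₁ refl , J) (_ , inj₁ refl , J′) = descent-unique _ _ i<k J J′
      -- One lift leaves from the spine vertex and the other from its neighbour along `e`;
      -- `descent-e` forbids the former.
      same i<k (_ , inj₁ refl , J) (_ , inj₂ Je , _) =
        contradiction (level-spine (ℕ.<⇒≤ i<k)) (proj₁ (descent-e i<k Je) _ J)
      same i<k (_ , inj₂ Je , _) (_ , inj₁ refl , J) =
        contradiction (level-spine (ℕ.<⇒≤ i<k)) (proj₁ (descent-e i<k Je) _ J)
      same i<k (x , inj₂ Je , J) (x′ , inj₂ Je′ , J′) with joins-same H e Je Je′
      ... | inj₁ (refl , _) = proj₂ (proj₂ (descent-e i<k Je)) _ _ J J′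
      ... | inj₂ (p , _)    = contradiction p (joins⇒≢ H e Je)

  -- Merging the levels of a and b while dropping the spine vertex on the level of
  -- a leaves at most b on the spine; if b is there, then a was the spine vertex
  -- below it, and the contracted vertex inherits the descending edge of a.
  contract-upward : ∀ {k a b} (L : Layering H (suc k)) → Joins H e a b →
                    Layering.level L a ≤ Layering.level L b → Layering K k
  contract-upward {k} {a} {b} L Jab a≤b =
    layering _ _ (contracted (drop j L) level-e descent-e)
    where
    open Layering L
    j = level a

    b≤1+a : level b ≤ suc j
    b≤1+a = lipschitz e (swap Jab)

    level-e : ∀ {x y} → Joins H e x y → merge j (level x) ≡ merge j (level y)
    level-e J with joins-same H e J Jab
    ... | inj₁ (refl , refl) = sym (merge-level a≤b b≤1+a)
    ... | inj₂ (refl , refl) = merge-level a≤b b≤1+a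

    spine-edge : ∀ {x i} → i < k → Joins H e x (spine (skip j (suc i))) →
                 j ≡ suc i × level (spine (skip j (suc i))) ≡ suc j × x ≡ spine (suc i)
    spine-edge {x} {i} i<k J
      with l ← level-spine (≤-trans (skip≤ j (suc i)) (s≤s i<k))
      with joins-same H e J Jab
    -- The end on the spine cannot be `a`, whose level is the one skipped.
    ... | inj₂ (_ , p) = contradiction (trans (sym l) (cong level p)) (skip≢ j (suc i))
    ... | inj₁ (refl , p) = sym 1+i≡j , trans (cong level p) lb ,
      descent e (s≤s i<k)
        (swap (subst (λ n → Joins H e x (spine n)) (trans skip≡ (cong suc (sym 1+i≡j))) J))
        (sym 1+i≡j)
      where
      lb : level b ≡ suc j
      lb = ≤-antisym b≤1+a (ℕ.≤∧≢⇒< a≤b λ eq →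
        skip≢ j (suc i) (trans (sym l) (trans (cong level p) (sym eq))))
      skip≡ : skip j (suc i) ≡ suc j
      skip≡ = trans (sym l) (trans (cong level p) lb)
      1+i≡j : suc i ≡ j
      1+i≡j = skip-here j (suc i) skip≡

    descent-e : ∀ {x i} → i < k → Joins H e x (spine (skip j (suc i))) →
      (∀ g {y} → Joins H g (spine (skip j (suc i))) y → merge j (level y) ≢ i) ×
      (∀ g {y} → Joins H g x y → merge j (level y) ≡ i → y ≡ spine (skip j i)) ×
      (∀ g h → Joins H g x (spine (skip j i)) → Joins H h x (spine (skip j i)) → g ≡ h)
    descent-e {x} {i} i<k J with j≡ , top , refl ← spine-edge i<k J =
      -- Before merging, this spine vertex was on level `i + 2`, too high for an edge to level `i`.
      (λ g {y} J′ m → 1+n≰n (subst₂ (λ a b → a ≤ suc b) (trans top (cong suc j≡)) (lower y m)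
                                    (lipschitz g J′))) ,
      (λ g {y} J′ m → trans (descent g i<1+k J′ (lower y m)) (cong spine (sym skip≡))) ,
      (λ g h J′ J″ → descent-unique g h i<1+k (move g J′) (move h J″))
      where
      i<1+k : i < suc k
      i<1+k = m≤n⇒m≤1+n i<k
      lower : ∀ y → merge j (level y) ≡ i → level y ≡ i
      lower y m = merge-below i (level y) (subst (λ n → merge n (level y) ≡ i) j≡ m)
      skip≡ : skip j i ≡ i
      skip≡ = trans (cong (λ n → skip n i) j≡) (skip-below i)
      move : ∀ g → Joins H g (spine (suc i)) (spine (skip j i)) →
             Joins H g (spine (suc i)) (spine i)
      move g = subst (λ n → Joins H g (spine (suc i)) (spine n)) skip≡

  inherits-contract : Inherits H K
  inherits-contract = inherits-smaller contraction-< λ L →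
    [ contract-upward L (joins-ends H e) , contract-upward L (swap (joins-ends H e)) ]′
      (ℕ.≤-total (Layering.level L _) (Layering.level L _))

inherits-⟶ : ∀ {H G} → H ⟶ G → Inherits H G
inherits-⟶ (deleteVertex _ D) = inherits-deleteVertex D
inherits-⟶ (deleteEdge _ D)   = inherits-deleteEdge D
inherits-⟶ (contract _ C)     = inherits-contract C

inherits-≼ : ∀ {G H} → G ≼ H → Inherits H G
inherits-≼ {G} (_ , steps , iso) = go steps iso
  where
  go : ∀ {H K} → Star _⟶_ H K → K ≅ G → Inherits H G
  go ε        iso = inherits-≅ iso
  go (s ◅ ss) iso = inherits-trans (inherits-⟶ s) (go ss iso)

-- Filling the gaps of a spine.

module _ (G : Graph) (a b : Vertex G) (a≢b : a ≢ b) where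

  addEdge : Graph
  addEdge = record
    { order    = order G
    ; size     = suc (size G)
    ; nonEmpty = nonEmpty G
    ; ends     = λ { zero → a , b ; (suc e) → ends G e }
    ; loopless = λ { zero → a≢b ; (suc e) → loopless G e }
    }

  ⊑-addEdge : G ⊑ addEdge
  ⊑-addEdge = record
    { onVertices = id ; onEdges = suc
    ; onVertices-injective = id ; onEdges-injective = Fin.suc-injective
    ; preserves = λ _ _ _ → id
    }

  addEdge-⟶ : addEdge ⟶ G
  addEdge-⟶ = deleteEdge zero record
    { onVertices = ↔-id _
    ; onEdges    = suc
    ; allBut     = record
      { injective = Fin.suc-injective
      ; image     = λ y → mk⇔ (λ { (_ , refl) () })
                              (λ { y≢0 → predecessor y y≢0 })
      }
    ; preserves  = λ _ _ _ → id
    }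
    where
    predecessor : ∀ (y : Fin (suc (size G))) → y ≢ zero → ∃[ x ] suc x ≡ y
    predecessor zero    y≢0 = contradiction refl y≢0
    predecessor (suc x) _   = x , refl

module _ {G k} (L : Layering G k) {i} (i<k : i < k) where
  open Layering L

  spine-≢ : spine i ≢ spine (suc i)
  spine-≢ eq = ℕ.1+n≢n (trans (sym (level-spine i<k))
                          (trans (cong level (sym eq)) (level-spine (ℕ.<⇒≤ i<k))))

  -- The new edge joins consecutive levels and descends to the right spine vertex; the gap ensures
  -- that it has no parallel edge.
  fillGap : ¬ SpineEdge L i → IsLayering (addEdge G (spine i) (spine (suc i)) spine-≢) k level spine
  fillGap gap = record
    { level-spine    = level-spine
    ; lipschitz      = lipschitz′
    ; descent        = descent′
    ; descent-unique = unique′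
    }
    where
    G⁺ = addEdge G (spine i) (spine (suc i)) spine-≢

    low : level (spine i) ≡ i
    low = level-spine (ℕ.<⇒≤ i<k)

    high : level (spine (suc i)) ≡ suc i
    high = level-spine i<k

    lipschitz′ : ∀ e {x y} → Joins G⁺ e x y → level x ≤ suc (level y)
    lipschitz′ zero (inj₁ refl) =
      subst₂ (λ m n → m ≤ suc n) (sym low) (sym high) (m≤n⇒m≤1+n (ℕ.n≤1+n i))
    lipschitz′ zero (inj₂ refl) =
      subst₂ (λ m n → m ≤ suc n) (sym high) (sym low) ≤-refl
    lipschitz′ (suc e) J = lipschitz e J

    new-level : ∀ {l y} → l < k → Joins G⁺ zero (spine (suc l)) y → level y ≡ l →
                l ≡ i × y ≡ spine i
    -- In this orientation the new edge would ascend from `spine (suc l)` to `y`, although `y` is on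
    -- level `l`.
    new-level l<k (inj₁ p) refl =
      contradiction (trans (sym (level-spine l<k)) (trans (cong (level ∘ proj₁) (sym p)) low))
        (ℕ.>⇒≢ (s≤s (ℕ.<⇒≤ (≤-reflexive (trans (sym high) (cong (level ∘ proj₂) p))))))
    new-level l<k (inj₂ p) refl =
      trans (cong (level ∘ proj₁) (sym p)) low , cong proj₁ (sym p)

    descent′ : ∀ e {l y} → l < k → Joins G⁺ e (spine (suc l)) y → level y ≡ l → y ≡ spine l
    descent′ zero    l<k J eq with refl , y≡ ← new-level l<k J eq = y≡
    descent′ (suc e) l<k J eq = descent e l<k J eq

    unique′ : ∀ e f {l} → l < k → Joins G⁺ e (spine (suc l)) (spine l) →
              Joins G⁺ f (spine (suc l)) (spine l) → e ≡ f
    unique′ zero    zero    l<k J J′ = refl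
    unique′ zero    (suc f) l<k J J′ with refl , _ ← new-level l<k J (level-spine (ℕ.<⇒≤ l<k)) =
      contradiction (f , swap J′) gap
    unique′ (suc e) zero    l<k J J′ with refl , _ ← new-level l<k J′ (level-spine (ℕ.<⇒≤ l<k)) =
      contradiction (e , swap J) gap
    unique′ (suc e) (suc f) l<k J J′ = cong suc (descent-unique e f l<k J J′)

spineEdge? : ∀ {G k} (L : Layering G k) i → Dec (SpineEdge L i)
spineEdge? {G} L i = any? λ e → joins? G e _ _

-- The state after the spine positions below `i` have been treated; `deletions` undoes the additions
-- and so shows `G` to be a minor.
record Completion (G : Graph) (k i : ℕ) : Set where
  field
    graph      : Graph
    same-order : order graph ≡ order G
    extends    : G ⊑ graph
    deletions  : Star _⟶_ graph G
    layers     : Layering graph k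
    spanned    : ∀ {j} → j < i → SpineEdge layers j

complete : ∀ {G k} → Layering G k → ∀ i → i ≤ k → Completion G k i
complete {G} L zero    _   = record
  { graph = G ; same-order = refl ; extends = ⊑-refl ; deletions = ε ; layers = L ; spanned = λ () }
complete {G} {k} L (suc i) i<k = extend (spineEdge? layers i)
  where
  open Completion (complete L i (ℕ.<⇒≤ i<k))
  open Layering layers using (level; spine)

  extend : Dec (SpineEdge layers i) → Completion G k (suc i)
  extend (yes s)  = record
    { graph = graph ; same-order = same-order ; extends = extends ; deletions = deletions
    ; layers = layers ; spanned = λ j≤i → [ spanned , (λ { refl → s }) ]′ (ℕ.m<1+n⇒m<n∨m≡n j≤i) }
  extend (no gap) = record
    { graph      = addEdge graph (spine i) (spine (suc i)) (spine-≢ layers i<k)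
    ; same-order = same-order
    ; extends    = ⊑-trans extends (⊑-addEdge graph _ _ (spine-≢ layers i<k))
    ; deletions  = addEdge-⟶ graph _ _ (spine-≢ layers i<k) ◅ deletions
    ; layers     = layering level spine (fillGap layers i<k gap)
    ; spanned    = λ j≤i → [ old , (λ { refl → zero , inj₁ refl }) ]′ (ℕ.m<1+n⇒m<n∨m≡n j≤i)
    }
    where
    old : ∀ {j} → j < i →
          ∃[ e ] Joins (addEdge graph (spine i) (spine (suc i)) (spine-≢ layers i<k)) e
                       (spine j) (spine (suc j))
    old j<i with e , J ← spanned j<i = suc e , J

-- Finding the largest layering.

-- The `k + 1` spine vertices are told apart by their levels.
layering-< : ∀ {G k} → Layering G k → k < order G
layering-< {k = k} L = injective⇒≤ {f = λ (x : Fin (suc k)) → spine (toℕ x)} λ {x} {y} eq →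
  toℕ-injective (trans (sym (at-level x)) (trans (cong level eq) (at-level y)))
  where
  open Layering L
  at-level : ∀ (x : Fin (suc k)) → level (spine (toℕ x)) ≡ toℕ x
  at-level x = level-spine (s≤s⁻¹ (toℕ<n x))

anyVec? : ∀ {m n} {P : Vec (Fin m) n → Set} → (∀ v → Dec (P v)) → Dec (∃[ v ] P v)
anyVec? {n = zero}  P? = map′ ([] ,_) (λ { ([] , p) → p }) (P? [])
anyVec? {n = suc n} P? =
  map′ (λ { (x , v , p) → x ∷ v , p }) (λ { (x ∷ v , p) → x , v , p })
    (any? λ x → anyVec? λ v → P? (x ∷ v))

allBelow? : ∀ {P : ℕ → Set} → (∀ i → Dec (P i)) → ∀ n → Dec (∀ i → i < n → P i)
allBelow? P? n = map′ (λ f _ i<n → f i<n) (λ f {i} → f i) (ℕ.allUpTo? P? n)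

module _ (G : Graph) (k : ℕ) where

  isLayering? : ∀ level spine → Dec (IsLayering G k level spine)
  isLayering? level spine =
    map′ (λ { (a , b , c , d) → record
                { level-spine    = λ i≤k → a _ (s≤s i≤k)
                ; lipschitz      = λ e → b e _ _
                ; descent        = λ e i<k → c _ i<k e _
                ; descent-unique = λ e f i<k → d _ i<k e f } })
         (λ L → let open IsLayering L in
                (λ _ i<1+k → level-spine (s≤s⁻¹ i<1+k)) , (λ e _ _ → lipschitz e) ,
                (λ _ i<k e _ → descent e i<k) , (λ _ i<k e f → descent-unique e f i<k))
      (allBelow? (λ i → level (spine i) ℕ.≟ i) (suc k)
       ×-dec all? (λ e → all? λ x → all? λ y →
               joins? G e x y →-dec level x ℕ.≤? suc (level y))
       ×-dec allBelow? (λ i → all? λ e → all? λ y →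
               joins? G e (spine (suc i)) y →-dec level y ℕ.≟ i →-dec y ≟ spine i) k
       ×-dec allBelow? (λ i → all? λ e → all? λ f →
               joins? G e (spine (suc i)) (spine i) →-dec
               joins? G f (spine (suc i)) (spine i) →-dec e ≟ f) k)

  levelOf : Vec (Fin (suc k)) (order G) → Vertex G → ℕ
  levelOf ls = toℕ ∘ lookup ls

  -- Reduction modulo `suc k` only serves to make the spine total; it fixes every index up to `k`.
  spineOf : Vec (Vertex G) (suc k) → ℕ → Vertex G
  spineOf vs i = lookup vs (i mod suc k)

  toℕ-mod : ∀ {i} → i ≤ k → toℕ (i mod suc k) ≡ i
  toℕ-mod {i} i≤k = trans (toℕ-fromℕ< (m%n<n i (suc k))) (m≤n⇒m%n≡m i≤k)

  -- Levels can be truncated at `k` and only `k + 1` spine values matter, so searching finitely many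
  -- pairs of vectors is exhaustive.
  layering? : Dec (Layering G k)
  layering? =
    map′ (λ { (ls , vs , p) → layering (levelOf ls) (spineOf vs) p })
         (λ L → let open Layering L in
           tabulate (λ x → (level x ⊓ k) mod suc k) , tabulate (spine ∘ toℕ) ,
           restrict ⊑-refl L
             (λ x → trans (cong toℕ (lookup∘tabulate _ x)) (toℕ-mod (ℕ.m⊓n≤n (level x) k)))
             (λ {i} i≤k → trans (lookup∘tabulate (spine ∘ toℕ) (i mod suc k))
                                (cong spine (toℕ-mod i≤k))))
      (anyVec? λ ls → anyVec? λ vs → isLayering? (levelOf ls) (spineOf vs))

greatest : ∀ {P : ℕ → Set} → (∀ k → Dec (P k)) → P 0 → ∀ n →
           ∃[ m ] (P m × (∀ {k} → k ≤ n → P k → k ≤ m))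
greatest P? p₀ zero = 0 , p₀ , λ { z≤n _ → z≤n }
greatest P? p₀ (suc n) with P? (suc n)
... | yes p = suc n , p , λ k≤1+n _ → k≤1+n
... | no ¬p with m , p , max ← greatest P? p₀ n = m , p , λ k≤1+n q →
        [ (λ k<1+n → max (s≤s⁻¹ k<1+n) q) , (λ { refl → contradiction q ¬p }) ]′
          (ℕ.m≤n⇒m<n∨m≡n k≤1+n)

-- The spectator floor.

∸-exchange : ∀ a b c d → a + d ≤ c + b → a ∸ b ≤ c ∸ d
∸-exchange a b c d le = ℕ.m≤n+o⇒m∸n≤o a b (ℕ.+-cancelʳ-≤ d a (b + (c ∸ d)) (begin
  a + d             ≤⟨ le ⟩
  c + b             ≡⟨ ℕ.+-comm c b ⟩
  b + c             ≤⟨ ℕ.+-monoʳ-≤ b (ℕ.m≤n+m∸n c d) ⟩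
  b + (d + (c ∸ d)) ≡⟨ cong (b +_) (ℕ.+-comm d (c ∸ d)) ⟩
  b + ((c ∸ d) + d) ≡⟨ ℕ.+-assoc b (c ∸ d) d ⟨
  b + (c ∸ d) + d   ∎))
  where open ℕ.≤-Reasoning

≅-refl : ∀ {G} → G ≅ G
≅-refl = record { onVertices = ↔-id _ ; onEdges = ↔-id _ ; preserves = λ _ _ _ → id }

theorem2p9 : (G : Graph) → ∃[ G′ ] (order G′ ≡ order G × G ⊑ G′ × (∃[ s ] (IsSpectatorFloor G s × IsSpectatorNumber G′ s)))
-- By `layering-<`, the search bound `order G` excludes no layering.
theorem2p9 G with m , L , max ← greatest (layering? G) (trivial G) (order G) =
  graph , same-order , extends , order graph ∸ suc m ,
  ((graph , G≼G′ , spectators) , floor) , spectators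
  where
  open Completion (complete L m ≤-refl)

  G≼G′ : G ≼ graph
  G≼G′ = G , deletions , ≅-refl

  -- Used twice: for the completed graph it shows that no unique shortest path has more vertices
  -- than the spine, and for arbitrary `H` it gives the lower bound on the floor.
  bound : ∀ {H p} → G ≼ H → HasUniqueShortestPathOfOrder H p → order G + p ≤ order H + suc m
  bound {H} minor (_ , _ , k , P , usp , refl)
    with k′ , L′ , le ← inherits-≼ minor (usp⇒layering P usp) = begin
    order G + suc k   ≡⟨ ℕ.+-suc (order G) k ⟩
    suc (order G + k) ≤⟨ s≤s le ⟩
    suc (order H + k′) ≤⟨ s≤s (ℕ.+-monoʳ-≤ (order H) (max (ℕ.<⇒≤ (layering-< L′)) L′)) ⟩
    suc (order H + m) ≡⟨ ℕ.+-suc (order H) m ⟨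
    order H + suc m   ∎
    where open ℕ.≤-Reasoning

  spectators : IsSpectatorNumber graph (order graph ∸ suc m)
  spectators = suc m , (spanned⇒usp layers spanned , λ q usp →
    ℕ.+-cancelˡ-≤ (order G) q (suc m)
      (subst (λ n → order G + q ≤ n + suc m) same-order (bound G≼G′ usp))) , refl

  floor : ∀ H t → G ≼ H → IsSpectatorNumber H t → order graph ∸ suc m ≤ t
  floor H t minor (p , (usp , _) , refl) =
    subst (λ n → n ∸ suc m ≤ order H ∸ p) (sym same-order)
      (∸-exchange (order G) (suc m) (order H) p (bound minor usp))
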